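{- For every message $M$ and formula $\phi$: $\vdash\mathsf{k}_{\mathsf{CM}}(M)\to([M]\phi\leftrightarrow\phi)$.
   Context: Fix a finite set $\mathcal{A}$ of agent names containing a distinguished name $\mathsf{CM}$. Messages: $M ::= a \mid B \mid (M,M)$ ($a\in\mathcal{A}$, $B$ optional data constants, pairs). $\mathcal{P}$ is a denumerable set of propositional variables containing atoms $\mathsf{k}_a(M)$ ("$a$ knows $M$"). Formulas: $\phi ::= P \mid \phi\wedge\phi \mid \phi\vee\phi \mid \neg\phi \mid \phi\to\phi \mid [M]\phi$. Abbreviations: $\mathrm{true}:=\mathsf{k}_{\mathsf{CM}}(\mathsf{CM})$, $\mathrm{false}:=\neg\mathrm{true}$, $\phi\leftrightarrow\psi:=(\phi\to\psi)\wedge(\psi\to\phi)$, $\langle M\rangle\phi:=\neg\neg(\mathsf{k}_{\mathsf{CM}}(M)\wedge\phi)$. LIiP is the smallest set of formulas containing all instances of: the axioms of an adequate Hilbert axiomatization of intuitionistic propositional logic; $\mathsf{k}_a(a)$; $(\mathsf{k}_a(M)\wedge\mathsf{k}_a(M'))\leftrightarrow\mathsf{k}_a((M,M'))$; $[M]\mathsf{k}_{\mathsf{CM}}(M)$; $[M](\phi\to\psi)\to([M]\phi\to[M]\psi)$; $[M]\phi\to(\mathsf{k}_{\mathsf{CM}}(M)\to\phi)$; $[M]\phi\to\langle M\rangle\phi$; $\phi\to[M]\phi$; and closed under modus ponens and the rule: if $\mathsf{k}_{\mathsf{CM}}(M)\to\mathsf{k}_{\mathsf{CM}}(M')$ is in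 the set then so is $[M']\phi\to[M]\phi$ for every $\phi$. Write $\vdash\phi$ for $\phi\in\mathrm{LIiP}$. -}

module Defs where

open import Data.Nat using (ℕ)
open import Data.Fin using (Fin)
open import Data.Product using (_×_; _,_; ∃-syntax)
open import Function.Bundles using (_↔_; _↣_; Injection)

data Message (Agent Const : Set) : Set where
  agent : Agent → Message Agent Const
  const : Const → Message Agent Const
  pair  : Message Agent Const → Message Agent Const → Message Agent Const

record Signature : Set₁ where
  field
    Agent        : Set
    Agent-finite : ∃[ n ] Agent ↔ Fin n
    CM           : Agent
    -- Data constants are optional: Const may be empty.
    Const        : Set

  Msg : Set
  Msg = Message Agent Const

  field
    PropVar             : Set
    PropVar-denumerable : PropVar ↔ ℕ
    -- The atoms k_a(M) are pairwise distinct propositional variables; there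
    -- may be others.
    knows               : (Agent × Msg) ↣ PropVar

module LIiP (S : Signature) where
  open Signature S public

  infix  30 ¬_ [_]_ ⟨_⟩_
  infixr 25 _∧_
  infixr 24 _∨_
  infixr 20 _⇒_
  infix  19 _⇔_
  infix  10 ⊢_

  data Formula : Set where
    var         : PropVar → Formula
    _∧_ _∨_ _⇒_ : Formula → Formula → Formula
    ¬_          : Formula → Formula
    [_]_        : Msg → Formula → Formula

  k : Agent → Msg → Formula
  k a M = var (Injection.to knows (a , M))

  true false : Formula
  true  = k CM (agent CM)
  false = ¬ true

  _⇔_ : Formula → Formula → Formula
  φ ⇔ ψ = (φ ⇒ ψ) ∧ (ψ ⇒ φ)

  ⟨_⟩_ : Msg → Formula → Formula
  ⟨ M ⟩ φ = ¬ (¬ (k CM M ∧ φ))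

  -- The intuitionistic propositional base is Kleene's Hilbert system with
  -- primitive negation (the constructors K to exfalso, with mp); every schema
  -- ranges over all formulas, including those with modalities.
  data ⊢_ : Formula → Set where
    K        : ∀ φ ψ → ⊢ φ ⇒ (ψ ⇒ φ)
    S-ax     : ∀ φ ψ χ → ⊢ (φ ⇒ (ψ ⇒ χ)) ⇒ ((φ ⇒ ψ) ⇒ (φ ⇒ χ))
    ∧-intro  : ∀ φ ψ → ⊢ φ ⇒ (ψ ⇒ (φ ∧ ψ))
    ∧-elimˡ  : ∀ φ ψ → ⊢ (φ ∧ ψ) ⇒ φ
    ∧-elimʳ  : ∀ φ ψ → ⊢ (φ ∧ ψ) ⇒ ψ
    ∨-introˡ : ∀ φ ψ → ⊢ φ ⇒ (φ ∨ ψ)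
    ∨-introʳ : ∀ φ ψ → ⊢ ψ ⇒ (φ ∨ ψ)
    ∨-elim   : ∀ φ ψ χ → ⊢ (φ ⇒ χ) ⇒ ((ψ ⇒ χ) ⇒ ((φ ∨ ψ) ⇒ χ))
    ¬-intro  : ∀ φ ψ → ⊢ (φ ⇒ ψ) ⇒ ((φ ⇒ (¬ ψ)) ⇒ (¬ φ))
    exfalso  : ∀ φ ψ → ⊢ (¬ φ) ⇒ (φ ⇒ ψ)

    self-knowledge   : ∀ a → ⊢ k a (agent a)
    pairing          : ∀ a M M′ → ⊢ (k a M ∧ k a M′) ⇔ k a (pair M M′)
    self-proof       : ∀ M → ⊢ [ M ] k CM M
    distribution     : ∀ M φ ψ → ⊢ ([ M ] (φ ⇒ ψ)) ⇒ (([ M ] φ) ⇒ ([ M ] ψ))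
    truthfulness     : ∀ M φ → ⊢ ([ M ] φ) ⇒ (k CM M ⇒ φ)
    proof-possible   : ∀ M φ → ⊢ ([ M ] φ) ⇒ (⟨ M ⟩ φ)
    fact-proof       : ∀ M φ → ⊢ φ ⇒ ([ M ] φ)

    mp         : ∀ {φ ψ} → ⊢ φ ⇒ ψ → ⊢ φ → ⊢ ψ
    antitone   : ∀ {M M′} → ⊢ k CM M ⇒ k CM M′ → ∀ φ → ⊢ ([ M′ ] φ) ⇒ ([ M ] φ)

{-# OPTIONS --safe #-}
module Submission where

open import Defs

-- Each direction of the equivalence is one axiom. `truthfulness`, with its two premises exchanged,
-- gives `[ M ] φ ⇒ φ` under `k CM M`; `fact-proof` gives the converse outright.

module HilbertCombinators (S : Signature) where
  open LIiP S

  ⇒-trans : ∀ {φ ψ χ} → ⊢ φ ⇒ ψ → ⊢ ψ ⇒ χ → ⊢ φ ⇒ χ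
  ⇒-trans p q = mp (mp (S-ax _ _ _) (mp (K _ _) q)) p

  ⇒-swap : ∀ {φ ψ χ} → ⊢ φ ⇒ (ψ ⇒ χ) → ⊢ ψ ⇒ (φ ⇒ χ)
  ⇒-swap p = ⇒-trans (K _ _) (mp (S-ax _ _ _) p)

  ∧-introʳ : ∀ {φ ψ} → ⊢ ψ → ⊢ φ ⇒ (φ ∧ ψ)
  ∧-introʳ q = mp (⇒-swap (∧-intro _ _)) q

theorem2p10 : (S : Signature) → let open LIiP S in
    (M : Msg) (φ : Formula) → ⊢ k CM M ⇒ (([ M ] φ) ⇔ φ)
theorem2p10 S M φ =
  -- The second conjunct of `⇔` is already a theorem, so it is attached to the conclusion by
  -- composition, with no deduction theorem.
  ⇒-trans (⇒-swap (truthfulness M φ)) (∧-introʳ (fact-proof M φ))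
  where
  open LIiP S
  open HilbertCombinators S
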